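{- Let $k_1,\dots,k_l\ge 1$ be integers, let $n=k_1+\dots+k_l$, and let $H$ be the bipartite graph with $n$ vertices on each side that is the disjoint union of the complete bipartite graphs $K_{k_1,k_1},\dots,K_{k_l,k_l}$. Then $H$ has the highest number of perfect matchings among all bipartite graphs with the same left-vertex degrees: for every bipartite graph $G=(X\cup Y,E)$ with $|X|=|Y|=n$ whose multiset of degrees of vertices in $X$ equals that of the left vertices of $H$ (the value $k_j$ taken $k_j$ times for each $j=1,\dots,l$), one has $\mathcal{M}(G)\le\mathcal{M}(H)$.
   Context: Graphs are simple. A bipartite graph $G=(X\cup Y,E)$ has vertex bipartition $X$ (left) and $Y$ (right) with $|X|=|Y|=n$. A perfect matching is a set of $n$ edges such that every vertex is incident to exactly one of them. $\mathcal{M}(G)$ denotes the number of perfect matchings of $G$. $K_{k,k}$ is the complete bipartite graph with $k$ vertices on each side (a complete bipartite component "of size $k$"); each component $K_{k_j,k_j}$ contributes $k_j$ vertices to each side. -}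

module Defs where

open import Data.Bool.Base using (true; false)
open import Data.Fin.Base using (Fin)
open import Data.Fin.Properties using (all?)
open import Data.Fin.Subset using (Subset; inside; outside; _⊆_; ∣_∣; ⊤; ⊥)
open import Data.Fin.Subset.Properties using (_⊆?_)
open import Data.List.Base as List
  using (List; []; _∷_; [_]; cartesianProductWith; filter; length)
open import Data.List.Membership.Propositional using (_∈_)
open import Data.List.Membership.Propositional.Properties using (∈-cartesianProductWith⁺)
open import Data.List.Relation.Unary.All using ([]; _∷_)
open import Data.List.Relation.Unary.Any using (here; there)
open import Data.List.Relation.Unary.AllPairs using ([]; _∷_)
open import Data.List.Relation.Unary.Unique.Propositional using (Unique)
open import Data.List.Relation.Unary.Unique.Propositional.Properties using (cartesianProductWith⁺)
open import Data.Nat.Base using (ℕ; zero; suc; _+_)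
open import Data.Nat.ListAction using (sum)
open import Data.Nat.Properties using (_≟_)
open import Data.Product.Base using (_×_; _,_)
open import Data.Vec.Base as Vec using (Vec; []; _∷_; lookup; transpose; replicate; _++_)
open import Data.Vec.Properties using (∷-injective)
open import Relation.Binary.PropositionalEquality using (_≡_; refl)
open import Relation.Nullary.Decidable using (Dec; _×-dec_; map′)

-- A set of edges between the left vertices Fin m and the right vertices Fin n
-- (two disjoint copies): row x is the set of right ends of the edges at x.
EdgeSet : ℕ → ℕ → Set
EdgeSet m n = Vec (Subset n) m

-- Simple bipartite graphs with a fixed bipartition are determined by their
-- edge sets, and perfect matchings below are edge sets too.
BipartiteGraph : ℕ → ℕ → Set
BipartiteGraph = EdgeSet

leftDegree : ∀ {m n} → EdgeSet m n → Fin m → ℕ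
leftDegree E x = ∣ lookup E x ∣

rightDegree : ∀ {m n} → EdgeSet m n → Fin n → ℕ
rightDegree E y = ∣ lookup (transpose E) y ∣

leftDegrees : ∀ {m n} → EdgeSet m n → List ℕ
leftDegrees E = List.tabulate (leftDegree E)

size : ∀ {m n} → EdgeSet m n → ℕ
size E = sum (leftDegrees E)

record IsPerfectMatching {n} (G : BipartiteGraph n n) (M : EdgeSet n n) : Set where
  constructor isPerfectMatching
  field
    edges⊆     : ∀ x → lookup M x ⊆ lookup G x
    size≡n     : size M ≡ n
    left-once  : ∀ x → leftDegree M x ≡ 1
    right-once : ∀ y → rightDegree M y ≡ 1

isPerfectMatching? : ∀ {n} (G : BipartiteGraph n n) (M : EdgeSet n n) →
                     Dec (IsPerfectMatching G M)
isPerfectMatching? {n} G M = map′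
  (λ (e , s , l , r) → isPerfectMatching e s l r)
  (λ p → let open IsPerfectMatching p in edges⊆ , size≡n , left-once , right-once)
  (all? (λ x → lookup M x ⊆? lookup G x)
    ×-dec size M ≟ n
    ×-dec all? (λ x → leftDegree M x ≟ 1)
    ×-dec all? (λ y → rightDegree M y ≟ 1))

vecs : ∀ {A : Set} → List A → ∀ n → List (Vec A n)
vecs xs zero    = [ [] ]
vecs xs (suc n) = cartesianProductWith _∷_ xs (vecs xs n)

subsets : ∀ n → List (Subset n)
subsets = vecs (inside ∷ outside ∷ [])

edgeSets : ∀ m n → List (EdgeSet m n)
edgeSets m n = vecs (subsets n) m

-- Every edge set is listed exactly once in edgeSets, so filtering that list
-- counts correctly.

∈-vecs : ∀ {A : Set} {xs : List A} → (∀ x → x ∈ xs) → ∀ {n} (v : Vec A n) → v ∈ vecs xs n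
∈-vecs all []      = here refl
∈-vecs all (x ∷ v) = ∈-cartesianProductWith⁺ _∷_ (all x) (∈-vecs all v)

vecs-unique : ∀ {A : Set} {xs : List A} → Unique xs → ∀ n → Unique (vecs xs n)
vecs-unique u zero    = [] ∷ []
vecs-unique u (suc n) = cartesianProductWith⁺ _∷_ ∷-injective u (vecs-unique u n)

∈-edgeSets : ∀ {m n} (E : EdgeSet m n) → E ∈ edgeSets m n
∈-edgeSets = ∈-vecs (∈-vecs λ { true → here refl ; false → there (here refl) })

edgeSets-unique : ∀ m n → Unique (edgeSets m n)
edgeSets-unique m n =
  vecs-unique (vecs-unique (((λ ()) ∷ []) ∷ [] ∷ []) n) m

#perfectMatchings : ∀ {n} → BipartiteGraph n n → ℕ
#perfectMatchings {n} G = length (filter (isPerfectMatching? G) (edgeSets n n))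

K : ∀ m n → BipartiteGraph m n
K m n = replicate m ⊤

infixr 5 _⊎ᴳ_

-- Disjoint union: the vertices of the first graph precede those of the second
-- on both sides.
_⊎ᴳ_ : ∀ {m n m′ n′} → BipartiteGraph m n → BipartiteGraph m′ n′ →
       BipartiteGraph (m + m′) (n + n′)
G ⊎ᴳ H = Vec.map (_++ ⊥) G ++ Vec.map (⊥ ++_) H

⨄K : (ks : List ℕ) → BipartiteGraph (sum ks) (sum ks)
⨄K []       = []
⨄K (k ∷ ks) = K k k ⊎ᴳ ⨄K ks

{-# OPTIONS --safe #-}

-- This is the case of Brègman's theorem, perm A ≤ ∏ᵢ (rᵢ !) ^ (1 / rᵢ) for a
-- 0-1 matrix A with row sums rᵢ, in which the bound is ∏ⱼ kⱼ ! and is attained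
-- by ⨄K. Schrijver's proof is followed, by induction on the number of rows. Let
-- P = perm A and let p i k be the number of matchings through the edge i k; all
-- row and column sums of the matrix p equal P. Row i of p has at most rᵢ nonzero
-- entries, so the log-sum inequality gives P ^ P ≤ rᵢ ^ P * ∏ₖ p i k ^ p i k.
-- Multiply over i and bound the minor p i k by induction: the exponents of all
-- factors are then partial row and column sums of p, hence known multiples of P,
-- and a P-th root can be taken. To stay within ℕ everything is raised to the
-- power L = n !, a common multiple of the rᵢ.

module Submission where

open import Algebra.Bundles using (Monoid)
import Algebra.Properties.CommutativeMonoid.Sum as Sum
import Algebra.Properties.Monoid.Sum as MonoidSum
import Algebra.Properties.Semiring.Sum as SemiringSum
open import Data.Bool.Base using (Bool; true; false; if_then_else_)
open import Data.Fin.Base using (Fin; zero; suc; _↑ˡ_; _↑ʳ_)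
open import Data.Fin.Properties using (all?) renaming (_≟_ to _≟ᶠ_)
open import Data.Fin.Subset
  using (Subset; Side; ⁅_⁆; ⊥; ⊤; _⊆_; _∈_; ∣_∣; inside; outside; Nonempty)
open import Data.Fin.Subset.Properties
  using (nonempty?; _⊆?_; x∈⁅y⁆⇒x≡y; x∈⁅x⁆; ∣⊤∣≡n; ∣⊥∣≡0)
open import Data.List.Base as List using (List; []; _∷_; cartesianProductWith; filter; length)
open import Data.List.Properties
  using (filter-++; length-++; filter-≐; filter-none; filter-accept; map-++; map-∘)
open import Data.List.Relation.Binary.Permutation.Propositional using (_↭_)
open import Data.List.Relation.Binary.Permutation.Propositional.Properties using (map⁺)
open import Data.List.Relation.Unary.All using (All; universal)
open import Data.Nat.Base
open import Data.Nat.DivMod using (m/n*n≡m)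
open import Data.Nat.Divisibility using (∣-trans; m∣m*n; m≤n⇒m!∣n!)
open import Data.Nat.ListAction using (sum; product)
open import Data.Nat.ListAction.Properties using (sum-++; product-↭)
open import Data.Nat.Properties
open import Data.Nat.Tactic.RingSolver using (solve-∀)
open import Data.Product.Base using (_×_; _,_)
open import Data.Sum.Base using (inj₁; inj₂)
open import Data.Vec.Base as Vec
  using ([]; _∷_; here; there; lookup; _[_]≔_; _++_; replicate; transpose)
open import Data.Vec.Functional using (tail; removeAt)
open import Data.Vec.Properties
  using (lookup∘update; lookup∘update′; []≔-commutes; lookup-replicate; lookup⇒[]=; []=⇒lookup;
         lookup-⊛; lookup-map; lookup-++ˡ; lookup-++ʳ; []≔-++-↑ˡ; []≔-++-↑ʳ; map-replicate)
open import Defs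
open import Function.Base using (_∘_)
open import Function.Bundles using (mk⇔)
open import Level using (0ℓ)
open import Relation.Binary.PropositionalEquality
open import Relation.Nullary.Decidable using (does; yes; no; _×-dec_; dec-true; does-⇔)
open import Relation.Nullary.Negation using (contradiction; ¬_)
open import Relation.Unary using (Pred; Decidable)

open Sum +-0-commutativeMonoid using (sum-syntax; sum-cong-≗; ∑-comm; ∑-distrib-+)
  renaming (sum to sumᶠ)
open SemiringSum +-*-semiring using (*-distribˡ-sum; *-distribʳ-sum)
open Sum *-1-commutativeMonoid using ()
  renaming (sum to productᶠ; sum-cong-≗ to prod-cong-≗; sum-remove to prod-remove;
            ∑-comm to ∏-comm; ∑-distrib-+ to ∏-distrib-*)

infixl 10 prod-syntax

prod-syntax : ∀ n → (Fin n → ℕ) → ℕ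
prod-syntax _ = productᶠ

syntax prod-syntax n (λ i → x) = ∏[ i < n ] x

-- Powers, AM-GM and the log-sum inequality

*-^-distribʳ : ∀ a b n → (a * b) ^ n ≡ a ^ n * b ^ n
*-^-distribʳ a b zero    = refl
*-^-distribʳ a b (suc n) =
  trans (cong (a * b *_) (*-^-distribʳ a b n)) (lemma a b (a ^ n) (b ^ n))
  where
  lemma : ∀ a b c d → a * b * (c * d) ≡ a * c * (b * d)
  lemma = solve-∀

2xy≤x²+y² : ∀ x y → 2 * (x * y) ≤ x * x + y * y
2xy≤x²+y² x y with ≤-total x y
... | inj₁ x≤y with (d , refl) ← m≤n⇒∃[o]m+o≡n x≤y = m+n≤o⇒m≤o _ (≤-reflexive (lemma x d))
  where
  lemma : ∀ x d → 2 * (x * (x + d)) + d * d ≡ x * x + (x + d) * (x + d)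
  lemma = solve-∀
... | inj₂ y≤x with (d , refl) ← m≤n⇒∃[o]m+o≡n y≤x = m+n≤o⇒m≤o _ (≤-reflexive (lemma y d))
  where
  lemma : ∀ y d → 2 * ((y + d) * y) + d * d ≡ (y + d) * (y + d) + y * y
  lemma = solve-∀

-- The graph of y ↦ y ^ (1 + n) lies above its tangent at a.
tangent-≤ : ∀ n a y → suc n * (a ^ n * y) ≤ y ^ suc n + n * a ^ suc n
tangent-≤ zero    a y = ≤-reflexive (lemma y)
  where
  lemma : ∀ y → 1 * (1 * y) ≡ y * 1 + 0
  lemma = solve-∀
-- Adding `n * (a ^ suc n * y)` raises the coefficient on the left to `2 * suc n`, so that
-- `2xy≤x²+y²` applies and leaves `y` times the induction hypothesis.
tangent-≤ (suc n) a y = +-cancelʳ-≤ (n * (a ^ suc n * y)) _ _ (begin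
  suc (suc n) * (a ^ suc n * y) + n * (a ^ suc n * y)
    ≡⟨ e₁ n a y (a ^ n) ⟩
  suc n * a ^ n * (2 * (y * a))
    ≤⟨ *-monoʳ-≤ (suc n * a ^ n) (2xy≤x²+y² y a) ⟩
  suc n * a ^ n * (y * y + a * a)
    ≡⟨ e₂ n a y (a ^ n) ⟩
  y * (suc n * (a ^ n * y)) + suc n * a ^ suc (suc n)
    ≤⟨ +-monoˡ-≤ _ (*-monoʳ-≤ y (tangent-≤ n a y)) ⟩
  y * (y ^ suc n + n * a ^ suc n) + suc n * a ^ suc (suc n)
    ≡⟨ e₃ n a y (a ^ n) (y ^ n) ⟩
  y ^ suc (suc n) + suc n * a ^ suc (suc n) + n * (a ^ suc n * y) ∎)
  where
  open ≤-Reasoning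
  e₁ : ∀ n a y c → suc (suc n) * (a * c * y) + n * (a * c * y) ≡ suc n * c * (2 * (y * a))
  e₁ = solve-∀
  e₂ : ∀ n a y c → suc n * c * (y * y + a * a) ≡
                   y * (suc n * (c * y)) + suc n * (a * (a * c))
  e₂ = solve-∀
  e₃ : ∀ n a y c d → y * (y * d + n * (a * c)) + suc n * (a * (a * c)) ≡
                     y * (y * d) + suc n * (a * (a * c)) + n * (a * c * y)
  e₃ = solve-∀

-- The induction step of the AM-GM inequality: x is added to n numbers with total s.
am-gm-step : ∀ n s x → suc n ^ suc n * (s ^ n * x) ≤ n ^ n * (s + x) ^ suc n
am-gm-step zero    s x = begin
  1 * (1 * x)      ≡⟨ cong (1 *_) (*-identityˡ x) ⟩
  1 * x            ≤⟨ *-monoʳ-≤ 1 (m≤n+m x s) ⟩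
  1 * (s + x)      ≡⟨ cong (1 *_) (*-identityʳ (s + x)) ⟨
  1 * ((s + x) * 1) ∎
  where open ≤-Reasoning
-- The tangent at `suc n * s` is compared at the point `n * (s + x)`: the two coincide when `x` is
-- the mean `s / n`, the equality case. The term added on both sides is the `n * a ^ suc n` of
-- `tangent-≤`.
am-gm-step n@(suc _) s x = *-cancelˡ-≤ n (+-cancelʳ-≤ (n * (N * (s * s ^ n))) _ _ (begin
  n * (N * (s ^ n * x)) + n * (N * (s * s ^ n))
    ≡⟨ e₁ n (suc n ^ n) (s ^ n) s x ⟩
  suc n * (suc n ^ n * s ^ n * (n * (s + x)))
    ≡⟨ cong (λ z → suc n * (z * (n * (s + x)))) (*-^-distribʳ (suc n) s n) ⟨
  suc n * ((suc n * s) ^ n * (n * (s + x)))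
    ≤⟨ tangent-≤ n (suc n * s) (n * (s + x)) ⟩
  (n * (s + x)) ^ suc n + n * (suc n * s) ^ suc n
    ≡⟨ cong₂ (λ u v → u + n * v) (*-^-distribʳ n (s + x) (suc n)) (*-^-distribʳ (suc n) s (suc n)) ⟩
  n * n ^ n * (s + x) ^ suc n + n * (N * (s * s ^ n))
    ≡⟨ cong (_+ n * (N * (s * s ^ n))) (*-assoc n (n ^ n) _) ⟩
  n * (n ^ n * (s + x) ^ suc n) + n * (N * (s * s ^ n)) ∎))
  where
  open ≤-Reasoning
  N = suc n ^ suc n
  e₁ : ∀ n c d s x → n * (suc n * c * (d * x)) + n * (suc n * c * (s * d)) ≡
                     suc n * (c * d * (n * (s + x)))
  e₁ = solve-∀

-- As `0 ^ 0` is 1, such factors can be cancelled without treating empty sums separately.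
n^n≢0 : ∀ n → NonZero (n ^ n)
n^n≢0 zero    = _
n^n≢0 (suc n) = m^n≢0 (suc n) (suc n)

-- AM-GM for `p` copies of `a` and `q` copies of `b`, cleared of denominators. It starts from `p`
-- equal numbers, where equality holds, and adds one `b` at a time by `am-gm-step`.
weighted-am-gm : ∀ p q a b → (p + q) ^ (p + q) * (a ^ p * b ^ q) ≤ (p * a + q * b) ^ (p + q)
weighted-am-gm p zero a b rewrite +-identityʳ p | +-identityʳ (p * a) | *-identityʳ (a ^ p) =
  ≤-reflexive (sym (*-^-distribʳ p a p))
weighted-am-gm p (suc q) a b rewrite +-suc p q =
  *-cancelˡ-≤ (n ^ n) {{n^n≢0 n}} (begin
    n ^ n * (suc n ^ suc n * (a ^ p * (b * b ^ q)))
      ≡⟨ e₁ (n ^ n) (suc n ^ suc n) (a ^ p) b (b ^ q) ⟩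
    suc n ^ suc n * (n ^ n * (a ^ p * b ^ q) * b)
      ≤⟨ *-monoʳ-≤ (suc n ^ suc n) (*-monoˡ-≤ b (weighted-am-gm p q a b)) ⟩
    suc n ^ suc n * (s ^ n * b)
      ≤⟨ am-gm-step n s b ⟩
    n ^ n * (s + b) ^ suc n
      ≡⟨ cong (λ z → n ^ n * z ^ suc n) (e₂ (p * a) q b) ⟩
    n ^ n * (p * a + suc q * b) ^ suc n ∎)
  where
  open ≤-Reasoning
  n = p + q
  s = p * a + q * b
  e₁ : ∀ c d e b f → c * (d * (e * (b * f))) ≡ d * (c * (e * f) * b)
  e₁ = solve-∀
  e₂ : ∀ c q b → c + q * b + b ≡ c + suc q * b
  e₂ = solve-∀

-- The two-term log-sum inequality in exponential form: weighted AM-GM with weights `s` and `t` for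
-- the numbers `e / s` and `d / t`. A zero weight leaves only monotonicity of powers.
log-sum-step : ∀ s e t d → (s + t) ^ (s + t) * (e ^ s * d ^ t) ≤ (e + d) ^ (s + t) * (s ^ s * t ^ t)
log-sum-step zero e t d = begin
  t ^ t * (1 * d ^ t)        ≡⟨ lemma (t ^ t) (d ^ t) ⟩
  d ^ t * (1 * t ^ t)        ≤⟨ *-monoˡ-≤ (1 * t ^ t) (^-monoˡ-≤ t (m≤n+m d e)) ⟩
  (e + d) ^ t * (1 * t ^ t)  ∎
  where
  open ≤-Reasoning
  lemma : ∀ a b → a * (1 * b) ≡ b * (1 * a)
  lemma = solve-∀
log-sum-step s@(suc _) e zero d =
  subst (λ r → r ^ r * (e ^ s * 1) ≤ (e + d) ^ r * (s ^ s * 1)) (sym (+-identityʳ s)) (begin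
    s ^ s * (e ^ s * 1)        ≡⟨ lemma (s ^ s) (e ^ s) ⟩
    e ^ s * (s ^ s * 1)        ≤⟨ *-monoˡ-≤ (s ^ s * 1) (^-monoˡ-≤ s (m≤m+n e d)) ⟩
    (e + d) ^ s * (s ^ s * 1)  ∎)
  where
  open ≤-Reasoning
  lemma : ∀ a b → a * (b * 1) ≡ b * (a * 1)
  lemma = solve-∀
-- Scaling `e / s` and `d / t` by `s * t` gives the integers `t * e` and `s * d`; the surplus factor
-- `t ^ s * s ^ t` appears on both sides.
log-sum-step s@(suc _) e t@(suc _) d = *-cancelˡ-≤ (t ^ s * s ^ t) {{tˢsᵗ≢0}} (begin
  t ^ s * s ^ t * ((s + t) ^ (s + t) * (e ^ s * d ^ t))
    ≡⟨ e₁ (t ^ s) (s ^ t) ((s + t) ^ (s + t)) (e ^ s) (d ^ t) ⟩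
  (s + t) ^ (s + t) * (t ^ s * e ^ s * (s ^ t * d ^ t))
    ≡⟨ cong₂ (λ u v → (s + t) ^ (s + t) * (u * v)) (*-^-distribʳ t e s) (*-^-distribʳ s d t) ⟨
  (s + t) ^ (s + t) * ((t * e) ^ s * (s * d) ^ t)
    ≤⟨ weighted-am-gm s t (t * e) (s * d) ⟩
  (s * (t * e) + t * (s * d)) ^ (s + t)
    ≡⟨ cong (_^ (s + t)) (e₂ s t e d) ⟩
  ((e + d) * (s * t)) ^ (s + t)
    ≡⟨ *-^-distribʳ (e + d) (s * t) (s + t) ⟩
  (e + d) ^ (s + t) * (s * t) ^ (s + t)
    ≡⟨ cong ((e + d) ^ (s + t) *_) (trans (*-^-distribʳ s t (s + t))
         (cong₂ _*_ (^-distribˡ-+-* s s t) (^-distribˡ-+-* t s t))) ⟩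
  (e + d) ^ (s + t) * (s ^ s * s ^ t * (t ^ s * t ^ t))
    ≡⟨ e₃ ((e + d) ^ (s + t)) (s ^ s) (s ^ t) (t ^ s) (t ^ t) ⟩
  t ^ s * s ^ t * ((e + d) ^ (s + t) * (s ^ s * t ^ t)) ∎)
  where
  open ≤-Reasoning
  tˢsᵗ≢0 : NonZero (t ^ s * s ^ t)
  tˢsᵗ≢0 = m*n≢0 (t ^ s) (s ^ t) {{m^n≢0 t s}} {{m^n≢0 s t}}
  e₁ : ∀ a b c d e → a * b * (c * (d * e)) ≡ c * (a * d * (b * e))
  e₁ = solve-∀
  e₂ : ∀ s t e d → s * (t * e) + t * (s * d) ≡ (e + d) * (s * t)
  e₂ = solve-∀
  e₃ : ∀ a b c d e → a * (b * c * (d * e)) ≡ d * c * (a * (b * e))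
  e₃ = solve-∀

-- Exponential form of `Σ t log (t / e) ≥ T log (T / E)`, where `T` and `E` are the sums of `t` and
-- `e`. By induction the tail is lumped into a single term, and `log-sum-step` joins it to the head.
log-sum : ∀ {n} (t e : Fin n → ℕ) →
          sumᶠ t ^ sumᶠ t * ∏[ k < n ] (e k ^ t k) ≤ sumᶠ e ^ sumᶠ t * ∏[ k < n ] (t k ^ t k)
log-sum {zero}  t e = ≤-refl
log-sum {suc n} t e = *-cancelˡ-≤ (S ^ S) {{n^n≢0 S}} (begin
  S ^ S * ((t₀ + S) ^ (t₀ + S) * (e₀ ^ t₀ * Πe))
    ≡⟨ e₁ (S ^ S) ((t₀ + S) ^ (t₀ + S)) (e₀ ^ t₀) Πe ⟩
  (t₀ + S) ^ (t₀ + S) * e₀ ^ t₀ * (S ^ S * Πe)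
    ≤⟨ *-monoʳ-≤ ((t₀ + S) ^ (t₀ + S) * e₀ ^ t₀) (log-sum (t ∘ suc) (e ∘ suc)) ⟩
  (t₀ + S) ^ (t₀ + S) * e₀ ^ t₀ * (E ^ S * Πt)
    ≡⟨ e₂ ((t₀ + S) ^ (t₀ + S)) (e₀ ^ t₀) (E ^ S) Πt ⟩
  (t₀ + S) ^ (t₀ + S) * (e₀ ^ t₀ * E ^ S) * Πt
    ≤⟨ *-monoˡ-≤ Πt (log-sum-step t₀ e₀ S E) ⟩
  (e₀ + E) ^ (t₀ + S) * (t₀ ^ t₀ * S ^ S) * Πt
    ≡⟨ e₃ ((e₀ + E) ^ (t₀ + S)) (t₀ ^ t₀) (S ^ S) Πt ⟩
  S ^ S * ((e₀ + E) ^ (t₀ + S) * (t₀ ^ t₀ * Πt)) ∎)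
  where
  open ≤-Reasoning
  t₀ = t zero
  e₀ = e zero
  S  = sumᶠ (t ∘ suc)
  E  = sumᶠ (e ∘ suc)
  Πe = ∏[ k < n ] (e (suc k) ^ t (suc k))
  Πt = ∏[ k < n ] (t (suc k) ^ t (suc k))
  e₁ : ∀ a b c d → a * (b * (c * d)) ≡ b * c * (a * d)
  e₁ = solve-∀
  e₂ : ∀ a b c d → a * b * (c * d) ≡ a * (b * c) * d
  e₂ = solve-∀
  e₃ : ∀ a b c d → a * (b * c) * d ≡ c * (a * (b * d))
  e₃ = solve-∀

-- Powers and finite products

0^n≡0 : ∀ n .{{_ : NonZero n}} → 0 ^ n ≡ 0
0^n≡0 (suc n) = refl

prod-const : ∀ n b → ∏[ i < n ] b ≡ b ^ n
prod-const zero    b = refl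
prod-const (suc n) b = cong (b *_) (prod-const n b)

prod-mono-≤ : ∀ {n} {f g : Fin n → ℕ} → (∀ i → f i ≤ g i) → productᶠ f ≤ productᶠ g
prod-mono-≤ {zero}  f≤g = ≤-refl
prod-mono-≤ {suc n} f≤g = *-mono-≤ (f≤g zero) (prod-mono-≤ (f≤g ∘ suc))

prod-^ : ∀ {n} (f : Fin n → ℕ) e → ∏[ i < n ] (f i ^ e) ≡ productᶠ f ^ e
prod-^ {zero}  f e = sym (^-zeroˡ e)
prod-^ {suc n} f e =
  trans (cong (f zero ^ e *_) (prod-^ (f ∘ suc) e)) (sym (*-^-distribʳ (f zero) _ e))

^-sum : ∀ {n} b (e : Fin n → ℕ) → ∏[ i < n ] (b ^ e i) ≡ b ^ sumᶠ e
^-sum {zero}  b e = refl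
^-sum {suc n} b e =
  trans (cong (b ^ e zero *_) (^-sum b (e ∘ suc))) (sym (^-distribˡ-+-* b (e zero) _))

prod≢0 : ∀ {n} (f : Fin n → ℕ) → (∀ i → NonZero (f i)) → NonZero (productᶠ f)
prod≢0 {zero}  f nz = _
prod≢0 {suc n} f nz = m*n≢0 _ _ {{nz zero}} {{prod≢0 (f ∘ suc) (nz ∘ suc)}}

^-cancelʳ-≤ : ∀ n .{{_ : NonZero n}} {a b} → a ^ n ≤ b ^ n → a ≤ b
^-cancelʳ-≤ n aⁿ≤bⁿ = ≮⇒≥ λ b<a → <⇒≱ (^-monoˡ-< n b<a) aⁿ≤bⁿ

-- Permanents

𝟙 : Bool → ℕ
𝟙 b = if b then 1 else 0

χ : ∀ {N} → Subset N → Fin N → ℕ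
χ p k = 𝟙 (lookup p k)

infixl 6 _∖_

_∖_ : ∀ {N} → Subset N → Fin N → Subset N
C ∖ k = C [ k ]≔ outside

χ≤1 : ∀ {N} (p : Subset N) k → χ p k ≤ 1
χ≤1 p k with lookup p k
... | true  = ≤-refl
... | false = z≤n

χ-⊥ : ∀ {N} (k : Fin N) → χ ⊥ k ≡ 0
χ-⊥ k = cong 𝟙 (lookup-replicate k outside)

χ-⁅⁆-sym : ∀ {N} (k l : Fin N) → χ ⁅ k ⁆ l ≡ χ ⁅ l ⁆ k
χ-⁅⁆-sym zero    zero    = refl
χ-⁅⁆-sym zero    (suc l) = χ-⊥ l
χ-⁅⁆-sym (suc k) zero    = sym (χ-⊥ k)
χ-⁅⁆-sym (suc k) (suc l) = χ-⁅⁆-sym k l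

-- Splits off column `k` without subtraction; the factor `χ C k` covers the case `k` outside `C`,
-- where `C ∖ k` is `C`.
χ-∖ : ∀ {N} (C : Subset N) k l → χ C l ≡ χ ⁅ k ⁆ l * χ C k + χ (C ∖ k) l
χ-∖ (c ∷ C) zero    zero    = sym (trans (+-identityʳ _) (*-identityˡ (𝟙 c)))
χ-∖ (c ∷ C) zero    (suc l) = cong (λ z → z * 𝟙 c + χ C l) (sym (χ-⊥ l))
χ-∖ (c ∷ C) (suc k) zero    = refl
χ-∖ (c ∷ C) (suc k) (suc l) = χ-∖ C k l

sum-0 : ∀ {n} {f : Fin n → ℕ} → (∀ i → f i ≡ 0) → sumᶠ f ≡ 0
sum-0 {zero}  f≗0 = refl
sum-0 {suc n} f≗0 = cong₂ _+_ (f≗0 zero) (sum-0 (f≗0 ∘ suc))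

sum-⁅⁆ : ∀ {N} (k : Fin N) (f : Fin N → ℕ) → ∑[ l < N ] (χ ⁅ k ⁆ l * f l) ≡ f k
sum-⁅⁆ zero    f =
  trans (cong₂ _+_ (*-identityˡ (f zero)) (sum-0 λ l → cong (_* f (suc l)) (χ-⊥ l)))
        (+-identityʳ (f zero))
sum-⁅⁆ (suc k) f = sum-⁅⁆ k (f ∘ suc)

sum-1 : ∀ n → ∑[ i < n ] 1 ≡ n
sum-1 zero    = refl
sum-1 (suc n) = cong suc (sum-1 n)

sum-mono-≤ : ∀ {n} {f g : Fin n → ℕ} → (∀ i → f i ≤ g i) → sumᶠ f ≤ sumᶠ g
sum-mono-≤ {zero}  f≤g = ≤-refl
sum-mono-≤ {suc n} f≤g = +-mono-≤ (f≤g zero) (sum-mono-≤ (f≤g ∘ suc))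

-- The size of `p ∩ C`: the degree of a row `p` when only the columns in `C` remain.
deg : ∀ {N} → Subset N → Subset N → ℕ
deg {N} p C = ∑[ k < N ] (χ p k * χ C k)

deg≤N : ∀ {N} (p C : Subset N) → deg p C ≤ N
deg≤N {N} p C = subst (deg p C ≤_) (sum-1 N) (sum-mono-≤ λ k → *-mono-≤ (χ≤1 p k) (χ≤1 C k))

deg-∖ : ∀ {N} (p C : Subset N) k → deg p C ≡ χ p k * χ C k + deg p (C ∖ k)
deg-∖ {N} p C k = begin
  ∑[ l < N ] (χ p l * χ C l)
    ≡⟨ sum-cong-≗ (λ l → trans (cong (χ p l *_) (χ-∖ C k l)) (lemma (χ p l) (χ ⁅ k ⁆ l) (χ C k) _)) ⟩
  ∑[ l < N ] (χ ⁅ k ⁆ l * (χ p l * χ C k) + χ p l * χ (C ∖ k) l)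
    ≡⟨ ∑-distrib-+ _ (λ l → χ p l * χ (C ∖ k) l) ⟩
  ∑[ l < N ] (χ ⁅ k ⁆ l * (χ p l * χ C k)) + deg p (C ∖ k)
    ≡⟨ cong (_+ deg p (C ∖ k)) (sum-⁅⁆ k (λ l → χ p l * χ C k)) ⟩
  χ p k * χ C k + deg p (C ∖ k) ∎
  where
  open ≡-Reasoning
  lemma : ∀ a b c d → a * (b * c + d) ≡ b * (a * c) + a * d
  lemma = solve-∀

-- The number of systems of distinct representatives of the sets R i that use
-- each element of C exactly once.
permanent : ∀ {m N} → (Fin m → Subset N) → Subset N → ℕ
permanent {zero}      R C = if does (nonempty? C) then 0 else 1
permanent {suc m} {N} R C = ∑[ k < N ] (χ (R zero) k * χ C k * permanent (tail R) (C ∖ k))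

-- Among these, the number of those that represent R i by k.
through : ∀ {m N} → (Fin (suc m) → Subset N) → Subset N → Fin (suc m) → Fin N → ℕ
through R C i k = χ (R i) k * χ C k * permanent (removeAt R i) (C ∖ k)

-- Two rows may choose their columns `k` and `l` in either order. If `k` is `l`, both sides vanish,
-- since the second choice is already deleted.
∖-exchange : ∀ {N} (g : Subset N → ℕ) a b (C : Subset N) k l →
             a * χ C k * (b * χ (C ∖ k) l * g (C ∖ k ∖ l)) ≡
             b * χ C l * (a * χ (C ∖ l) k * g (C ∖ l ∖ k))
∖-exchange g a b C k l with k ≟ᶠ l
... | yes refl rewrite lookup∘update k C outside =
  lemma (a * χ C k) (b * χ C k) a b (g (C ∖ k ∖ k))
  where
  lemma : ∀ x y a b z → x * (b * 0 * z) ≡ y * (a * 0 * z)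
  lemma = solve-∀
... | no k≢l rewrite lookup∘update′ k≢l C outside | lookup∘update′ (k≢l ∘ sym) C outside
                   | []≔-commutes {x = outside} {y = outside} C k l k≢l =
  lemma a b (χ C k) (χ C l) (g (C ∖ l ∖ k))
  where
  lemma : ∀ a b x y z → a * x * (b * y * z) ≡ b * y * (a * x * z)
  lemma = solve-∀

-- Expands the minor along row zero and exchanges the two choices, so that row zero chooses first
-- and induction on the tail becomes possible.
through-suc : ∀ {m N} (R : Fin (suc (suc m)) → Subset N) C i k →
              through R C (suc i) k ≡
              ∑[ l < N ] (χ (R zero) l * χ C l * through (tail R) (C ∖ l) i k)
through-suc R C i k = trans
  (*-distribˡ-sum (χ (R (suc i)) k * χ C k) (λ l → χ (R zero) l * χ (C ∖ k) l * g (C ∖ k ∖ l)))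
  (sum-cong-≗ λ l → ∖-exchange g (χ (R (suc i)) k) (χ (R zero) l) C k l)
  where g = permanent (removeAt (tail R) i)

-- Laplace expansion along any row. For row zero it is the definition of `permanent`; a later row is
-- expanded inside the tail, after row zero has chosen.
sum-through-row : ∀ {m N} (R : Fin (suc m) → Subset N) C i →
                  ∑[ k < N ] through R C i k ≡ permanent R C
sum-through-row         R C zero    = refl
sum-through-row {suc m} {N} R C (suc i) = begin
  ∑[ k < N ] through R C (suc i) k
    ≡⟨ sum-cong-≗ (through-suc R C i) ⟩
  ∑[ k < N ] ∑[ l < N ] (w l * through (tail R) (C ∖ l) i k)
    ≡⟨ ∑-comm (λ k l → w l * through (tail R) (C ∖ l) i k) ⟩
  ∑[ l < N ] ∑[ k < N ] (w l * through (tail R) (C ∖ l) i k)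
    ≡⟨ sum-cong-≗ (λ l → *-distribˡ-sum (w l) (through (tail R) (C ∖ l) i)) ⟨
  ∑[ l < N ] (w l * ∑[ k < N ] through (tail R) (C ∖ l) i k)
    ≡⟨ sum-cong-≗ (λ l → cong (w l *_) (sum-through-row (tail R) (C ∖ l) i)) ⟩
  permanent R C ∎
  where
  open ≡-Reasoning
  w = λ l → χ (R zero) l * χ C l

-- Proved mutually with `sum-through-column`: once row zero has chosen `l`, the column expansion of
-- the tail applies to `C ∖ l`.
sum-through-tail : ∀ {m N} (R : Fin (suc m) → Subset N) C k →
  ∑[ i < m ] through R C (suc i) k ≡
  ∑[ l < N ] (χ (R zero) l * χ C l * (χ (C ∖ l) k * permanent (tail R) (C ∖ l)))

-- A column of `C` is used exactly once, either by row zero or by a later row while row zero takes a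
-- column `l` that leaves `k` in `C ∖ l`. The two cases recombine by `χ-∖`.
sum-through-column : ∀ {m N} (R : Fin (suc m) → Subset N) C k →
                     ∑[ i < suc m ] through R C i k ≡ χ C k * permanent R C
sum-through-column {m} {N} R C k = begin
  w k + ∑[ i < m ] through R C (suc i) k
    -- `w k` already contains the idempotent factor `χ C k`; repeating it gives the shape that
    -- `χ-∖ C l k` recombines.
    ≡⟨ cong₂ _+_ (χ-idem (χ (R zero) k)) (sum-through-tail R C k) ⟩
  χ C k * w k + ∑[ l < N ] (χ (R zero) l * χ C l * (χ (C ∖ l) k * permanent (tail R) (C ∖ l)))
    ≡⟨ cong₂ _+_ (sym (sum-⁅⁆ k λ l → χ C l * w l))
         (sum-cong-≗ λ l → e₁ (χ (R zero) l) (χ C l) (χ (C ∖ l) k) _) ⟩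
  ∑[ l < N ] (χ ⁅ k ⁆ l * (χ C l * w l)) + ∑[ l < N ] (χ (C ∖ l) k * w l)
    ≡⟨ ∑-distrib-+ (λ l → χ ⁅ k ⁆ l * (χ C l * w l)) (λ l → χ (C ∖ l) k * w l) ⟨
  ∑[ l < N ] (χ ⁅ k ⁆ l * (χ C l * w l) + χ (C ∖ l) k * w l)
    ≡⟨ sum-cong-≗ (λ l → trans (e₂ (χ ⁅ k ⁆ l) (χ C l) (w l) (χ (C ∖ l) k))
         (cong (_* w l) (trans (cong (λ z → z * χ C l + χ (C ∖ l) k) (χ-⁅⁆-sym k l)) (sym (χ-∖ C l k))))) ⟩
  ∑[ l < N ] (χ C k * w l)
    ≡⟨ *-distribˡ-sum (χ C k) w ⟨
  χ C k * permanent R C ∎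
  where
  open ≡-Reasoning
  w = λ l → χ (R zero) l * χ C l * permanent (tail R) (C ∖ l)
  χ-idem : ∀ a → a * χ C k * permanent (tail R) (C ∖ k) ≡ χ C k * (a * χ C k * permanent (tail R) (C ∖ k))
  χ-idem a with lookup C k
  ... | true  = sym (*-identityˡ _)
  ... | false = cong (_* permanent (tail R) (C ∖ k)) (*-zeroʳ a)
  e₁ : ∀ a b c d → a * b * (c * d) ≡ c * (a * b * d)
  e₁ = solve-∀
  e₂ : ∀ a b c d → a * (b * c) + d * c ≡ (a * b + d) * c
  e₂ = solve-∀

-- No row is left to use column `k`, so the permanent vanishes if `k` is still present.
sum-through-tail {zero} {N} R C k = sym (sum-0 λ l →
  trans (cong (χ (R zero) l * χ C l *_) (no-column (C ∖ l))) (*-zeroʳ (χ (R zero) l * χ C l)))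
  where
  no-column : ∀ D → χ D k * permanent (tail R) D ≡ 0
  no-column D with lookup D k in k∈D
  ... | false = refl
  ... | true rewrite dec-true (nonempty? D) (k , lookup⇒[]= k D k∈D) = refl
sum-through-tail {suc m} {N} R C k = begin
  ∑[ i < suc m ] through R C (suc i) k
    ≡⟨ sum-cong-≗ (λ i → through-suc R C i k) ⟩
  ∑[ i < suc m ] ∑[ l < N ] (w l * through (tail R) (C ∖ l) i k)
    ≡⟨ ∑-comm (λ i l → w l * through (tail R) (C ∖ l) i k) ⟩
  ∑[ l < N ] ∑[ i < suc m ] (w l * through (tail R) (C ∖ l) i k)
    ≡⟨ sum-cong-≗ (λ l → *-distribˡ-sum (w l) (λ i → through (tail R) (C ∖ l) i k)) ⟨
  ∑[ l < N ] (w l * ∑[ i < suc m ] through (tail R) (C ∖ l) i k)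
    ≡⟨ sum-cong-≗ (λ l → cong (w l *_) (sum-through-column (tail R) (C ∖ l) k)) ⟩
  ∑[ l < N ] (w l * (χ (C ∖ l) k * permanent (tail R) (C ∖ l))) ∎
  where
  open ≡-Reasoning
  w = λ l → χ (R zero) l * χ C l

-- With g r = L / r, the number f r below is the L-th power of the factor
-- (r !) ^ (1 / r) in Brègman's bound.
module Bregman {N L} .{{_ : NonZero L}} (g : ℕ → ℕ)
               (g*r≡L : ∀ r → .{{NonZero r}} → r ≤ N → g r * r ≡ L) where

  f : ℕ → ℕ
  f r = (r !) ^ g r

  f≢0 : ∀ r → NonZero (f r)
  f≢0 r = m^n≢0 (r !) (g r) {{r !≢0}}

  f^r : ∀ r .{{_ : NonZero r}} → r ≤ N → f r ^ r ≡ (r !) ^ L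
  f^r r r≤N = trans (^-*-assoc (r !) (g r) r) (cong ((r !) ^_) (g*r≡L r r≤N))

  -- Both sides equal `f (pred r) * (r !) ^ L`, by `f^r` at `r` and at `pred r`.
  f-step : ∀ r .{{_ : NonZero r}} → r ≤ N → r ^ L * f (pred r) ^ r ≡ f (pred r) * f r ^ r
  -- The hypothesis does not determine `g 0`, but `f 0` is a power of `0 !` and hence 1.
  f-step 1 1≤N = begin
    1 ^ L * (1 ^ g 0 * 1)      ≡⟨ cong₂ (λ u v → u * (v * 1)) (^-zeroˡ L) (^-zeroˡ (g 0)) ⟩
    1                          ≡⟨ cong₂ (λ u v → u * (v * 1)) (^-zeroˡ (g 0)) (^-zeroˡ (g 1)) ⟨
    1 ^ g 0 * (1 ^ g 1 * 1)    ∎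
    where open ≡-Reasoning
  f-step r@(suc (suc s)) r≤N = begin
    r ^ L * (f (suc s) * f (suc s) ^ suc s)
      ≡⟨ cong (λ z → r ^ L * (f (suc s) * z)) (f^r (suc s) (≤-trans (n≤1+n _) r≤N)) ⟩
    r ^ L * (f (suc s) * (suc s !) ^ L)
      ≡⟨ lemma (r ^ L) (f (suc s)) _ ⟩
    f (suc s) * (r ^ L * (suc s !) ^ L)
      ≡⟨ cong (f (suc s) *_) (*-^-distribʳ r (suc s !) L) ⟨
    f (suc s) * (r !) ^ L
      ≡⟨ cong (f (suc s) *_) (f^r r r≤N) ⟨
    f (suc s) * f r ^ r ∎
    where
    open ≡-Reasoning
    lemma : ∀ a b c → a * (b * c) ≡ b * (a * c)
    lemma = solve-∀

  card : Subset N → ℕ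
  card C = ∑[ k < N ] χ C k

  -- The L-th power of the factor of a row p in the bound for the minors that
  -- omit column k.
  F : Subset N → Subset N → Fin N → ℕ
  F C p k = f (deg p (C ∖ k))

  -- For `k` in `C`, the value `F C p k` is `f (pred r)` if `k` is in `p` and `f r` if not, with
  -- `r = deg p C`. The extra power of `f r` on the left avoids the exponent `card C - r`.
  F-pointwise : ∀ C p k → F C p k ^ χ C k * f (deg p C) ^ (χ p k * χ C k) ≡
                          f (pred (deg p C)) ^ (χ p k * χ C k) * f (deg p C) ^ χ C k
  F-pointwise C p k with lookup p k | lookup C k | deg-∖ p C k
  ... | false | false | _  = refl
  ... | true  | false | _  = refl
  ... | false | true  | eq rewrite eq = *-comm (f (deg p (C ∖ k)) ^ 1) 1
  ... | true  | true  | eq rewrite eq = refl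

  -- Of the columns in `C`, `r` give `f (pred r)` and the others `f r`; by `f-step`, the factor
  -- `r ^ L` turns all but one `f (pred r)` into the missing powers of `f r`.
  prod-F : ∀ C p .{{_ : NonZero (deg p C)}} →
           (deg p C) ^ L * ∏[ k < N ] (F C p k ^ χ C k) ≡ f (pred (deg p C)) * f (deg p C) ^ card C
  prod-F C p = *-cancelʳ-≡ _ _ (f r ^ r) {{m^n≢0 (f r) r {{f≢0 r}}}} (begin
    r ^ L * productᶠ D * f r ^ r
      ≡⟨ *-assoc (r ^ L) (productᶠ D) (f r ^ r) ⟩
    r ^ L * (productᶠ D * f r ^ r)
      ≡⟨ cong (λ z → r ^ L * (productᶠ D * z)) (^-sum (f r) e) ⟨
    r ^ L * (productᶠ D * ∏[ k < N ] (f r ^ e k))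
      ≡⟨ cong (r ^ L *_) (∏-distrib-* D (λ k → f r ^ e k)) ⟨
    r ^ L * ∏[ k < N ] (D k * f r ^ e k)
      ≡⟨ cong (r ^ L *_) (prod-cong-≗ (F-pointwise C p)) ⟩
    r ^ L * ∏[ k < N ] (f (pred r) ^ e k * f r ^ χ C k)
      ≡⟨ cong (r ^ L *_) (∏-distrib-* (λ k → f (pred r) ^ e k) (λ k → f r ^ χ C k)) ⟩
    r ^ L * (∏[ k < N ] (f (pred r) ^ e k) * ∏[ k < N ] (f r ^ χ C k))
      ≡⟨ cong (r ^ L *_) (cong₂ _*_ (^-sum (f (pred r)) e) (^-sum (f r) (χ C))) ⟩
    r ^ L * (f (pred r) ^ r * f r ^ card C)
      ≡⟨ *-assoc (r ^ L) _ _ ⟨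
    r ^ L * f (pred r) ^ r * f r ^ card C
      ≡⟨ cong (_* f r ^ card C) (f-step r (deg≤N p C)) ⟩
    f (pred r) * f r ^ r * f r ^ card C
      ≡⟨ lemma (f (pred r)) (f r ^ r) (f r ^ card C) ⟩
    f (pred r) * f r ^ card C * f r ^ r ∎)
    where
    open ≡-Reasoning
    r = deg p C
    D = λ k → F C p k ^ χ C k
    e = λ k → χ p k * χ C k
    lemma : ∀ a b c → a * b * c ≡ a * c * b
    lemma = solve-∀

  module Step {m} (R : Fin (suc m) → Subset N) (C : Subset N)
              (minor-bound : ∀ i k → permanent (removeAt R i) (C ∖ k) ^ L ≤
                                     ∏[ j < m ] F C (removeAt R i j) k) where

    P = permanent R C

    r : Fin (suc m) → ℕ
    r i = deg (R i) C

    e : Fin (suc m) → Fin N → ℕ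
    e i k = χ (R i) k * χ C k

    G : Fin N → ℕ
    G k = ∏[ j < suc m ] F C (R j) k

    -- The log-sum inequality against the indicator `e i`, whose sum is `r i`. Its powers are all 1:
    -- where `e i k` is 0, so is the exponent.
    P-log-sum : ∀ i → P ^ P ≤ r i ^ P * ∏[ k < N ] (through R C i k ^ through R C i k)
    P-log-sum i = subst
      (λ s → s ^ s ≤ r i ^ s * ∏[ k < N ] (through R C i k ^ through R C i k))
      (sum-through-row R C i)
      (≤-trans (≤-reflexive (sym ∏e≡1)) (log-sum (through R C i) (e i)))
      where
      s = sumᶠ (through R C i)
      e^eq : ∀ k → e i k ^ through R C i k ≡ 1
      e^eq k with lookup (R i) k | lookup C k
      ... | true  | true  = ^-zeroˡ (permanent (removeAt R i) (C ∖ k) + 0)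
      ... | true  | false = refl
      ... | false | _     = refl
      ∏e≡1 : s ^ s * ∏[ k < N ] (e i k ^ through R C i k) ≡ s ^ s
      ∏e≡1 = trans (cong (s ^ s *_) (trans (prod-cong-≗ e^eq) (trans (prod-const N 1) (^-zeroˡ N))))
                   (*-identityʳ _)

    -- On the support of row i, f (pred (r i)) is the factor j = i of G, which the
    -- bound for the minors omits; with it, G no longer depends on i.
    through-^-≤ : ∀ i k → (through R C i k ^ L) ^ through R C i k *
                          f (pred (r i)) ^ through R C i k ≤ G k ^ through R C i k
    through-^-≤ i k with lookup (R i) k | lookup C k | deg-∖ (R i) C k
    ... | false | _     | _  = ≤-refl
    ... | true  | false | _  = ≤-refl
    ... | true  | true  | eq rewrite +-identityʳ (permanent (removeAt R i) (C ∖ k)) | eq = begin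
      (q ^ L) ^ q * F C (R i) k ^ q
        ≡⟨ *-^-distribʳ (q ^ L) (F C (R i) k) q ⟨
      (q ^ L * F C (R i) k) ^ q
        ≤⟨ ^-monoˡ-≤ q (*-monoˡ-≤ (F C (R i) k) (minor-bound i k)) ⟩
      (∏[ j < m ] F C (removeAt R i j) k * F C (R i) k) ^ q
        ≡⟨ cong (_^ q) (*-comm _ (F C (R i) k)) ⟩
      (F C (R i) k * ∏[ j < m ] F C (removeAt R i j) k) ^ q
        ≡⟨ cong (_^ q) (prod-remove (λ j → F C (R j) k)) ⟨
      G k ^ q ∎
      where
      open ≤-Reasoning
      q = permanent (removeAt R i) (C ∖ k)

    -- The `L`-th power of `P-log-sum`, with `f (pred (r i)) ^ P` distributed over the columns
    -- because row `i` of `through` sums to `P`.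
    row-bound : ∀ i → (P ^ L * f (pred (r i))) ^ P ≤
                      (r i ^ L) ^ P * ∏[ k < N ] (G k ^ through R C i k)
    row-bound i = begin
      (P ^ L * f′) ^ P
        ≡⟨ *-^-distribʳ (P ^ L) f′ P ⟩
      (P ^ L) ^ P * f′ ^ P
        ≡⟨ cong (_* f′ ^ P) (^-comm P L P) ⟩
      (P ^ P) ^ L * f′ ^ P
        ≤⟨ *-monoˡ-≤ (f′ ^ P) (^-monoˡ-≤ L (P-log-sum i)) ⟩
      (r i ^ P * ∏[ k < N ] (t k ^ t k)) ^ L * f′ ^ P
        ≡⟨ cong₂ _*_ (*-^-distribʳ (r i ^ P) (∏[ k < N ] (t k ^ t k)) L)
             (cong (f′ ^_) (sym (sum-through-row R C i))) ⟩
      (r i ^ P) ^ L * (∏[ k < N ] (t k ^ t k)) ^ L * f′ ^ sumᶠ t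
        ≡⟨ *-assoc ((r i ^ P) ^ L) _ _ ⟩
      (r i ^ P) ^ L * ((∏[ k < N ] (t k ^ t k)) ^ L * f′ ^ sumᶠ t)
        ≡⟨ cong₂ _*_ (^-comm (r i) P L)
             (cong₂ _*_ (trans (sym (prod-^ (λ k → t k ^ t k) L)) (prod-cong-≗ λ k → ^-comm (t k) (t k) L))
                        (sym (^-sum f′ t))) ⟩
      (r i ^ L) ^ P * (∏[ k < N ] ((t k ^ L) ^ t k) * ∏[ k < N ] (f′ ^ t k))
        ≡⟨ cong ((r i ^ L) ^ P *_) (∏-distrib-* (λ k → (t k ^ L) ^ t k) (λ k → f′ ^ t k)) ⟨
      (r i ^ L) ^ P * ∏[ k < N ] ((t k ^ L) ^ t k * f′ ^ t k)
        ≤⟨ *-monoʳ-≤ ((r i ^ L) ^ P) (prod-mono-≤ (through-^-≤ i)) ⟩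
      (r i ^ L) ^ P * ∏[ k < N ] (G k ^ t k) ∎
      where
      open ≤-Reasoning
      f′ = f (pred (r i))
      t = through R C i
      ^-comm : ∀ a b c → (a ^ b) ^ c ≡ (a ^ c) ^ b
      ^-comm a b c = trans (^-*-assoc a b c) (trans (cong (a ^_) (*-comm b c)) (sym (^-*-assoc a c b)))

    -- After exchanging the products, the exponents of `G k` add up to a column sum, `χ C k * P`, so
    -- the whole is a `P`-th power.
    prod-G : ∏[ i < suc m ] ∏[ k < N ] (G k ^ through R C i k) ≡
             (∏[ j < suc m ] ∏[ k < N ] (F C (R j) k ^ χ C k)) ^ P
    prod-G = begin
      ∏[ i < suc m ] ∏[ k < N ] (G k ^ through R C i k)
        ≡⟨ ∏-comm (λ i k → G k ^ through R C i k) ⟩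
      ∏[ k < N ] ∏[ i < suc m ] (G k ^ through R C i k)
        ≡⟨ prod-cong-≗ (λ k → trans (^-sum (G k) (λ i → through R C i k))
             (trans (cong (G k ^_) (sum-through-column R C k)) (sym (^-*-assoc (G k) (χ C k) P)))) ⟩
      ∏[ k < N ] ((G k ^ χ C k) ^ P)
        ≡⟨ prod-^ (λ k → G k ^ χ C k) P ⟩
      (∏[ k < N ] (G k ^ χ C k)) ^ P
        ≡⟨ cong (_^ P) (prod-cong-≗ λ k → sym (prod-^ (λ j → F C (R j) k) (χ C k))) ⟩
      (∏[ k < N ] ∏[ j < suc m ] (F C (R j) k ^ χ C k)) ^ P
        ≡⟨ cong (_^ P) (∏-comm (λ k j → F C (R j) k ^ χ C k)) ⟩
      (∏[ j < suc m ] ∏[ k < N ] (F C (R j) k ^ χ C k)) ^ P ∎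
      where open ≡-Reasoning

    -- Double counting of the entries of `through R C`, by rows and by columns.
    m*P≡card*P : suc m * P ≡ card C * P
    m*P≡card*P = begin
      suc m * P                                ≡⟨ cong (_* P) (sum-1 (suc m)) ⟨
      ∑[ i < suc m ] 1 * P                     ≡⟨ *-distribʳ-sum {suc m} P (λ _ → 1) ⟩
      ∑[ i < suc m ] (1 * P)                   ≡⟨ sum-cong-≗ {suc m} (λ i →
                                                    trans (*-identityˡ P) (sym (sum-through-row R C i))) ⟩
      ∑[ i < suc m ] ∑[ k < N ] through R C i k ≡⟨ ∑-comm (through R C) ⟩
      ∑[ k < N ] ∑[ i < suc m ] through R C i k ≡⟨ sum-cong-≗ (sum-through-column R C) ⟩
      ∑[ k < N ] (χ C k * P)                   ≡⟨ *-distribʳ-sum P (χ C) ⟨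
      card C * P                               ∎
      where open ≡-Reasoning

    -- An empty row would make the right side of `P-log-sum` zero.
    r≢0 : .{{_ : NonZero P}} → ∀ i → NonZero (r i)
    r≢0 i = ≢-nonZero λ r≡0 → ≢-nonZero⁻¹ (P ^ P) {{m^n≢0 P P}} (n≤0⇒n≡0
      (≤-trans (P-log-sum i) (≤-reflexive
        (cong (_* ∏[ k < N ] (through R C i k ^ through R C i k)) (trans (cong (_^ P) r≡0) (0^n≡0 P))))))

    -- The product of all row bounds compares two `P`-th powers. After the root, the factors
    -- `f (pred (r i))` cancel by `prod-F`, and a `suc m`-th root remains because `card C` equals
    -- `suc m`.
    bound-nonZero : .{{_ : NonZero P}} → P ^ L ≤ ∏[ i < suc m ] f (r i)
    bound-nonZero = ^-cancelʳ-≤ (suc m) (*-cancelʳ-≤ _ _ Πf′ {{Πf′≢0}} (^-cancelʳ-≤ P (begin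
      ((P ^ L) ^ suc m * Πf′) ^ P
        ≡⟨ cong (λ z → (z * Πf′) ^ P) (prod-const (suc m) (P ^ L)) ⟨
      (∏[ i < suc m ] (P ^ L) * Πf′) ^ P
        ≡⟨ cong (_^ P) (∏-distrib-* {suc m} (λ _ → P ^ L) (λ i → f (pred (r i)))) ⟨
      (∏[ i < suc m ] (P ^ L * f (pred (r i)))) ^ P
        ≡⟨ prod-^ (λ i → P ^ L * f (pred (r i))) P ⟨
      ∏[ i < suc m ] ((P ^ L * f (pred (r i))) ^ P)
        ≤⟨ prod-mono-≤ row-bound ⟩
      ∏[ i < suc m ] ((r i ^ L) ^ P * ∏[ k < N ] (G k ^ through R C i k))
        ≡⟨ ∏-distrib-* (λ i → (r i ^ L) ^ P) (λ i → ∏[ k < N ] (G k ^ through R C i k)) ⟩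
      ∏[ i < suc m ] ((r i ^ L) ^ P) * ∏[ i < suc m ] ∏[ k < N ] (G k ^ through R C i k)
        ≡⟨ cong₂ _*_ (prod-^ (λ i → r i ^ L) P) prod-G ⟩
      (∏[ i < suc m ] (r i ^ L)) ^ P * (∏[ i < suc m ] D i) ^ P
        ≡⟨ *-^-distribʳ (∏[ i < suc m ] (r i ^ L)) (productᶠ D) P ⟨
      (∏[ i < suc m ] (r i ^ L) * ∏[ i < suc m ] D i) ^ P
        ≡⟨ cong (_^ P) (∏-distrib-* (λ i → r i ^ L) D) ⟨
      (∏[ i < suc m ] (r i ^ L * D i)) ^ P
        ≡⟨ cong (_^ P) (prod-cong-≗ λ i → prod-F C (R i) {{r≢0 i}}) ⟩
      (∏[ i < suc m ] (f (pred (r i)) * f (r i) ^ card C)) ^ P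
        ≡⟨ cong (_^ P) (∏-distrib-* (λ i → f (pred (r i))) (λ i → f (r i) ^ card C)) ⟩
      (Πf′ * ∏[ i < suc m ] (f (r i) ^ card C)) ^ P
        ≡⟨ cong (_^ P) (trans (*-comm Πf′ _) (cong (_* Πf′)
             (trans (prod-^ (f ∘ r) (card C))
               (cong (productᶠ (f ∘ r) ^_) (*-cancelʳ-≡ (card C) (suc m) P (sym m*P≡card*P)))))) ⟩
      ((∏[ i < suc m ] f (r i)) ^ suc m * Πf′) ^ P ∎)))
      where
      open ≤-Reasoning
      Πf′ = ∏[ i < suc m ] f (pred (r i))
      Πf′≢0 : NonZero Πf′
      Πf′≢0 = prod≢0 _ (λ i → f≢0 (pred (r i)))
      D = λ i → ∏[ k < N ] (F C (R i) k ^ χ C k)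

    bound : P ^ L ≤ ∏[ i < suc m ] f (r i)
    bound with P in eq
    ... | zero  = subst (_≤ ∏[ i < suc m ] f (r i)) (sym (0^n≡0 L)) z≤n
    ... | suc _ = subst (λ z → z ^ L ≤ ∏[ i < suc m ] f (r i)) eq
                        (bound-nonZero {{subst NonZero (sym eq) _}})

  -- Deleting a column only removes it from `C`, so `N`, `L` and `f` stay fixed throughout the
  -- induction on the number of rows.
  bregman : ∀ {m} (R : Fin m → Subset N) C → permanent R C ^ L ≤ ∏[ i < m ] f (deg (R i) C)
  bregman {zero}  R C = subst (permanent R C ^ L ≤_) (^-zeroˡ L) (^-monoˡ-≤ L ≤1)
    where
    ≤1 : permanent R C ≤ 1
    ≤1 with nonempty? C
    ... | yes _ = z≤n
    ... | no  _ = ≤-refl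
  bregman {suc m} R C = Step.bound R C (λ i k → bregman (removeAt R i) (C ∖ k))

-- Sums and products over concatenated index ranges

module _ {a ℓ} (M : Monoid a ℓ) where
  open Monoid M using (Carrier; _≈_; _∙_; identityˡ; assoc; ∙-congˡ)
  open Monoid M using () renaming (sym to ≈-sym; trans to ≈-trans)
  open MonoidSum M using () renaming (sum to fold)

  fold-↑ : ∀ m {n} (g : Fin (m + n) → Carrier) →
           fold g ≈ fold (g ∘ (_↑ˡ n)) ∙ fold (g ∘ (m ↑ʳ_))
  fold-↑ zero    g = ≈-sym (identityˡ _)
  fold-↑ (suc m) g = ≈-trans (∙-congˡ (fold-↑ m (g ∘ suc))) (≈-sym (assoc _ _ _))

sum-↑ : ∀ m {n} (g : Fin (m + n) → ℕ) → sumᶠ g ≡ ∑[ i < m ] g (i ↑ˡ n) + ∑[ i < n ] g (m ↑ʳ i)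
sum-↑ = fold-↑ +-0-monoid

prod-↑ : ∀ m {n} (g : Fin (m + n) → ℕ) → productᶠ g ≡ ∏[ i < m ] g (i ↑ˡ n) * ∏[ i < n ] g (m ↑ʳ i)
prod-↑ = fold-↑ *-1-monoid

-- Counting perfect matchings

module _ {A B : Set} {P : Pred B 0ℓ} (P? : Decidable P) where

  length-filter-map : (f : A → B) → ∀ xs →
    length (filter P? (List.map f xs)) ≡ length (filter (P? ∘ f) xs)
  length-filter-map f []       = refl
  length-filter-map f (x ∷ xs) with does (P? (f x))
  ... | true  = cong suc (length-filter-map f xs)
  ... | false = length-filter-map f xs

module _ {A B C : Set} {P : Pred C 0ℓ} (P? : Decidable P) (f : A → B → C) where

  length-filter-cartesianProductWith : ∀ xs ys →
    length (filter P? (cartesianProductWith f xs ys)) ≡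
    sum (List.map (λ x → length (filter (P? ∘ f x) ys)) xs)
  length-filter-cartesianProductWith []       ys = refl
  length-filter-cartesianProductWith (x ∷ xs) ys = begin
    length (filter P? (List.map (f x) ys List.++ cartesianProductWith f xs ys))
      ≡⟨ cong length (filter-++ P? (List.map (f x) ys) _) ⟩
    length (filter P? (List.map (f x) ys) List.++ filter P? (cartesianProductWith f xs ys))
      ≡⟨ length-++ (filter P? (List.map (f x) ys)) ⟩
    length (filter P? (List.map (f x) ys)) + length (filter P? (cartesianProductWith f xs ys))
      ≡⟨ cong₂ _+_ (length-filter-map P? (f x) ys) (length-filter-cartesianProductWith xs ys) ⟩
    length (filter (P? ∘ f x) ys) + sum (List.map (λ x → length (filter (P? ∘ f x) ys)) xs) ∎
    where open ≡-Reasoning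

length-filter-none : ∀ {A : Set} {P : Pred A 0ℓ} (P? : Decidable P) → (∀ x → ¬ P x) →
                     ∀ xs → length (filter P? xs) ≡ 0
length-filter-none P? ¬P xs = cong length (filter-none P? (universal ¬P xs))

sum-map-0 : ∀ {A : Set} {h : A → ℕ} → (∀ x → h x ≡ 0) → ∀ xs → sum (List.map h xs) ≡ 0
sum-map-0 h≗0 []       = refl
sum-map-0 h≗0 (x ∷ xs) = cong₂ _+_ (h≗0 x) (sum-map-0 h≗0 xs)

sum-subsets-suc : ∀ N (h : Subset (suc N) → ℕ) →
  sum (List.map h (subsets (suc N))) ≡
  sum (List.map (h ∘ (inside ∷_)) (subsets N)) + sum (List.map (h ∘ (outside ∷_)) (subsets N))
sum-subsets-suc N h = begin
  Σ (ins List.++ outs List.++ [])         ≡⟨ Σ-++ ins (outs List.++ []) ⟩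
  Σ ins + Σ (outs List.++ [])             ≡⟨ cong (Σ ins +_) (trans (Σ-++ outs []) (+-identityʳ (Σ outs))) ⟩
  Σ ins + Σ outs                          ≡⟨ cong₂ (λ u v → sum u + sum v) (map-∘ (subsets N)) (map-∘ (subsets N)) ⟨
  sum (List.map (h ∘ (inside ∷_)) (subsets N)) + sum (List.map (h ∘ (outside ∷_)) (subsets N)) ∎
  where
  open ≡-Reasoning
  ins  = List.map (inside ∷_) (subsets N)
  outs = List.map (outside ∷_) (subsets N)
  Σ = λ xs → sum (List.map h xs)
  Σ-++ : ∀ xs ys → Σ (xs List.++ ys) ≡ Σ xs + Σ ys
  Σ-++ xs ys = trans (cong sum (map-++ h xs ys)) (sum-++ (List.map h xs) (List.map h ys))

sum-subsets-⊥ : ∀ N (h : Subset N → ℕ) → (∀ p → ∣ p ∣ ≢ 0 → h p ≡ 0) →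
                sum (List.map h (subsets N)) ≡ h ⊥
sum-subsets-⊥ zero    h h≡0 = +-identityʳ (h [])
sum-subsets-⊥ (suc N) h h≡0 = trans (sum-subsets-suc N h) (cong₂ _+_
  (sum-map-0 (λ p → h≡0 (inside ∷ p) λ ()) (subsets N))
  (sum-subsets-⊥ N (h ∘ (outside ∷_)) (λ p → h≡0 (outside ∷ p))))

-- Used for a row of left degree 1. Once an element is inside, the rest must be `⊥`, which is
-- `sum-subsets-⊥`.
sum-subsets-⁅⁆ : ∀ N (h : Subset N → ℕ) → (∀ p → ∣ p ∣ ≢ 1 → h p ≡ 0) →
                 sum (List.map h (subsets N)) ≡ ∑[ k < N ] h ⁅ k ⁆
sum-subsets-⁅⁆ zero    h h≡0 = cong (_+ 0) (h≡0 [] λ ())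
sum-subsets-⁅⁆ (suc N) h h≡0 = trans (sum-subsets-suc N h) (cong₂ _+_
  (sum-subsets-⊥ N (h ∘ (inside ∷_)) (λ p ∣p∣≢0 → h≡0 (inside ∷ p) (∣p∣≢0 ∘ suc-injective)))
  (sum-subsets-⁅⁆ N (h ∘ (outside ∷_)) (λ p → h≡0 (outside ∷ p))))

-- Prescribing right degrees by `χ C` lets the rows and columns shrink as in the recursion of
-- `permanent`.
IsMatching : ∀ {m N} → (Fin m → Subset N) → Subset N → EdgeSet m N → Set
IsMatching R C M = (∀ x → lookup M x ⊆ R x) × (∀ x → leftDegree M x ≡ 1) ×
                   (∀ y → rightDegree M y ≡ χ C y)

isMatching? : ∀ {m N} (R : Fin m → Subset N) (C : Subset N) → Decidable (IsMatching R C)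
isMatching? R C M = all? (λ x → lookup M x ⊆? R x)
  ×-dec all? (λ x → leftDegree M x ≟ 1)
  ×-dec all? (λ y → rightDegree M y ≟ χ C y)

rightDegree-[] : ∀ {N} (y : Fin N) → rightDegree [] y ≡ 0
rightDegree-[] {N} y = cong ∣_∣ (lookup-replicate y [])

rightDegree-∷ : ∀ {m N} p (M : EdgeSet m N) y → rightDegree (p ∷ M) y ≡ χ p y + rightDegree M y
rightDegree-∷ {m} {N} p M y = trans (cong ∣_∣ row) (lemma (lookup p y) (lookup (transpose M) y))
  where
  cons : Side → Subset m → Subset (suc m)
  cons = _∷_
  row : lookup (transpose (p ∷ M)) y ≡ lookup p y ∷ lookup (transpose M) y
  row rewrite lookup-⊛ y (replicate N cons Vec.⊛ p) (transpose M) | lookup-⊛ y (replicate N cons) p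
            | lookup-replicate y cons = refl
  lemma : ∀ {n} b (q : Subset n) → ∣ b ∷ q ∣ ≡ 𝟙 b + ∣ q ∣
  lemma true  q = refl
  lemma false q = refl

∈⇒χ≡1 : ∀ {N} {p : Subset N} {k} → k ∈ p → χ p k ≡ 1
∈⇒χ≡1 k∈p = cong 𝟙 ([]=⇒lookup k∈p)

∣⁅⁆∣≡1 : ∀ {N} (k : Fin N) → ∣ ⁅ k ⁆ ∣ ≡ 1
∣⁅⁆∣≡1 {suc N} zero = cong suc (∣⊥∣≡0 N)
∣⁅⁆∣≡1 (suc k)      = ∣⁅⁆∣≡1 k

#matchings : ∀ {m N} → (Fin m → Subset N) → Subset N → ℕ
#matchings {m} {N} R C = length (filter (isMatching? R C) (edgeSets m N))

-- The first row forces the edge from `zero` to `k`. It must be allowed by both `R zero` and `C`,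
-- and then column `k` is used up for the remaining rows.
matchings-⁅⁆∷ : ∀ {m N} (R : Fin (suc m) → Subset N) C k →
  length (filter (isMatching? R C ∘ (⁅ k ⁆ ∷_)) (edgeSets m N)) ≡
  χ (R zero) k * χ C k * #matchings (tail R) (C ∖ k)
matchings-⁅⁆∷ {m} {N} R C k with lookup (R zero) k in k∈R | lookup C k in k∈C
... | false | _     = length-filter-none (isMatching? R C ∘ (⁅ k ⁆ ∷_))
  (λ M (sub , _) → contradiction (trans (sym k∈R) ([]=⇒lookup (sub zero (x∈⁅x⁆ k)))) λ ()) (edgeSets m N)
... | true  | false = length-filter-none (isMatching? R C ∘ (⁅ k ⁆ ∷_))
  (λ M (_ , _ , right) → contradiction
    (trans (sym (trans (right k) (cong 𝟙 k∈C)))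
           (trans (rightDegree-∷ ⁅ k ⁆ M k) (cong (_+ rightDegree M k) (∈⇒χ≡1 (x∈⁅x⁆ k))))) λ ())
  (edgeSets m N)
... | true  | true  = trans
  (cong length (filter-≐ (isMatching? R C ∘ (⁅ k ⁆ ∷_)) (isMatching? (tail R) (C ∖ k)) (to , from)
    (edgeSets m N)))
  (sym (*-identityˡ _))
  where
  χ-split : ∀ y → χ C y ≡ χ ⁅ k ⁆ y + χ (C ∖ k) y
  χ-split y = trans (χ-∖ C k y) (cong (_+ χ (C ∖ k) y)
    (trans (cong (λ b → χ ⁅ k ⁆ y * 𝟙 b) k∈C) (*-identityʳ _)))
  to : ∀ {M} → IsMatching R C (⁅ k ⁆ ∷ M) → IsMatching (tail R) (C ∖ k) M
  to {M} (sub , left , right) = sub ∘ suc , left ∘ suc , λ y → +-cancelˡ-≡ (χ ⁅ k ⁆ y) _ _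
    (trans (sym (rightDegree-∷ ⁅ k ⁆ M y)) (trans (right y) (χ-split y)))
  from : ∀ {M} → IsMatching (tail R) (C ∖ k) M → IsMatching R C (⁅ k ⁆ ∷ M)
  from {M} (sub , left , right) =
    (λ { zero    x∈⁅k⁆ → subst (_∈ R zero) (sym (x∈⁅y⁆⇒x≡y k x∈⁅k⁆)) (lookup⇒[]= k (R zero) k∈R)
       ; (suc x) → sub x }) ,
    (λ { zero → ∣⁅⁆∣≡1 k ; (suc x) → left x }) ,
    λ y → trans (rightDegree-∷ ⁅ k ⁆ M y) (trans (cong (χ ⁅ k ⁆ y +_) (right y)) (sym (χ-split y)))

-- Grouping edge sets by their first row reproduces the recursion of `permanent`: only singleton
-- rows have left degree 1.
#matchings≡permanent : ∀ {m N} (R : Fin m → Subset N) C → #matchings R C ≡ permanent R C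
#matchings≡permanent {zero} {N} R C with nonempty? C
... | yes (k , k∈C) = length-filter-none (isMatching? R C)
  (λ { [] (_ , _ , right) →
       contradiction (trans (sym (rightDegree-[] k)) (trans (right k) (∈⇒χ≡1 k∈C))) λ () })
  (edgeSets zero N)
... | no ¬C = cong length (filter-accept (isMatching? R C) {xs = []} ((λ ()) , (λ ()) , right))
  where
  right : ∀ y → rightDegree [] y ≡ χ C y
  right y with lookup C y in y∈C
  ... | true  = contradiction (y , lookup⇒[]= y C y∈C) ¬C
  ... | false = rightDegree-[] y
#matchings≡permanent {suc m} {N} R C = begin
  length (filter (isMatching? R C) (edgeSets (suc m) N))
    ≡⟨ length-filter-cartesianProductWith (isMatching? R C) _∷_ (subsets N) (edgeSets m N) ⟩
  sum (List.map h (subsets N))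
    ≡⟨ sum-subsets-⁅⁆ N h (λ p ∣p∣≢1 → length-filter-none (isMatching? R C ∘ (p ∷_))
         (λ M (_ , left , _) → ∣p∣≢1 (left zero)) (edgeSets m N)) ⟩
  ∑[ k < N ] h ⁅ k ⁆
    ≡⟨ sum-cong-≗ (λ k → trans (matchings-⁅⁆∷ R C k)
         (cong (χ (R zero) k * χ C k *_) (#matchings≡permanent (tail R) (C ∖ k)))) ⟩
  permanent R C ∎
  where
  open ≡-Reasoning
  h : Subset N → ℕ
  h p = length (filter (isMatching? R C ∘ (p ∷_)) (edgeSets m N))

χ-⊤ : ∀ {N} (k : Fin N) → χ ⊤ k ≡ 1
χ-⊤ k = cong 𝟙 (lookup-replicate k inside)

sum-tabulate : ∀ {n} (d : Fin n → ℕ) → sum (List.tabulate d) ≡ sumᶠ d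
sum-tabulate {zero}  d = refl
sum-tabulate {suc n} d = cong (d zero +_) (sum-tabulate (d ∘ suc))

#perfectMatchings≡permanent : ∀ {n} (G : BipartiteGraph n n) →
                              #perfectMatchings G ≡ permanent (lookup G) ⊤
#perfectMatchings≡permanent {n} G = trans
  (cong length (filter-≐ (isPerfectMatching? G) (isMatching? (lookup G) ⊤) (to , from) (edgeSets n n)))
  (#matchings≡permanent (lookup G) ⊤)
  where
  to : ∀ {M} → IsPerfectMatching G M → IsMatching (lookup G) ⊤ M
  to pm = edges⊆ , left-once , λ y → trans (right-once y) (sym (χ-⊤ y))
    where open IsPerfectMatching pm
  from : ∀ {M} → IsMatching (lookup G) ⊤ M → IsPerfectMatching G M
  from {M} (sub , left , right) = isPerfectMatching sub
    (trans (sum-tabulate (leftDegree M)) (trans (sum-cong-≗ left) (sum-1 n)))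
    left (λ y → trans (right y) (χ-⊤ y))

-- Disjoint unions of complete bipartite graphs

deg-⊤ : ∀ {N} (p : Subset N) → deg p ⊤ ≡ ∣ p ∣
deg-⊤ []          = refl
deg-⊤ (true ∷ p)  = cong suc (deg-⊤ p)
deg-⊤ (false ∷ p) = deg-⊤ p

deg-⊤-⊤ : ∀ N → deg (⊤ {N}) ⊤ ≡ N
deg-⊤-⊤ N = trans (deg-⊤ (⊤ {N})) (∣⊤∣≡n N)

deg-⊤≡0⇒≡⊥ : ∀ {N} (C : Subset N) → deg ⊤ C ≡ 0 → C ≡ ⊥
deg-⊤≡0⇒≡⊥ []          _  = refl
deg-⊤≡0⇒≡⊥ (false ∷ C) eq = cong (false ∷_) (deg-⊤≡0⇒≡⊥ C eq)

χ-++ˡ : ∀ {m n} (p : Subset m) (q : Subset n) i → χ (p ++ q) (i ↑ˡ n) ≡ χ p i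
χ-++ˡ p q i = cong 𝟙 (lookup-++ˡ p q i)

χ-++ʳ : ∀ {m n} (p : Subset m) (q : Subset n) i → χ (p ++ q) (m ↑ʳ i) ≡ χ q i
χ-++ʳ p q i = cong 𝟙 (lookup-++ʳ p q i)

⊥-++-nonempty : ∀ k {n} (C : Subset n) → does (nonempty? (⊥ {k} ++ C)) ≡ does (nonempty? C)
⊥-++-nonempty k C = does-⇔ (mk⇔ (to k) (from k)) (nonempty? (⊥ {k} ++ C)) (nonempty? C)
  where
  to : ∀ k → Nonempty (⊥ {k} ++ C) → Nonempty C
  to zero    ne                = ne
  to (suc k) (suc x , there i) = to k (x , i)
  from : ∀ k → Nonempty C → Nonempty (⊥ {k} ++ C)
  from zero    ne = ne
  from (suc k) ne with (x , i) ← from k ne = suc x , there i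

-- The `k` padding columns lie in no row, so their terms vanish from the expansion.
permanent-⊥++ : ∀ k {m n} (H : EdgeSet m n) C →
                permanent (lookup (Vec.map (⊥ {k} ++_) H)) (⊥ {k} ++ C) ≡ permanent (lookup H) C
permanent-⊥++ k []      C = cong (if_then 0 else 1) (⊥-++-nonempty k C)
permanent-⊥++ k {suc m} {n} (p ∷ H) C = begin
  sumᶠ g
    ≡⟨ sum-↑ k g ⟩
  ∑[ i < k ] g (i ↑ˡ n) + ∑[ i < n ] g (k ↑ʳ i)
    ≡⟨ cong₂ _+_ (sum-0 λ i → cong (λ z → z * χ (⊥ {k} ++ C) (i ↑ˡ n) * permanent H′ _)
                                   (trans (χ-++ˡ (⊥ {k}) p i) (χ-⊥ i)))
         (sum-cong-≗ λ i → cong₂ _*_ (cong₂ _*_ (χ-++ʳ (⊥ {k}) p i) (χ-++ʳ (⊥ {k}) C i))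
           (trans (cong (permanent H′) ([]≔-++-↑ʳ (⊥ {k}) C i)) (permanent-⊥++ k H (C ∖ i)))) ⟩
  permanent (lookup (p ∷ H)) C ∎
  where
  open ≡-Reasoning
  H′ = lookup (Vec.map (⊥ {k} ++_) H)
  g = λ l → χ (⊥ {k} ++ p) l * χ (⊥ {k} ++ C) l * permanent H′ ((⊥ {k} ++ C) ∖ l)

-- Generalizes a block of size `k` to its state after some rows are matched: `j` full rows and the
-- `j` columns in `C` remain. The next row has `j` choices, each leading to the same state for
-- `j - 1`, whence `j !`.
permanent-⊤++ : ∀ {k m n} (H : EdgeSet m n) D j (C : Subset k) → deg ⊤ C ≡ j →
  permanent (lookup (replicate j (⊤ {k} ++ ⊥ {n}) ++ Vec.map (⊥ {k} ++_) H)) (C ++ D) ≡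
  j ! * permanent (lookup H) D
permanent-⊤++ {k} H D zero    C ∣C∣≡0 rewrite deg-⊤≡0⇒≡⊥ C ∣C∣≡0 =
  trans (permanent-⊥++ k H D) (sym (+-identityʳ _))
permanent-⊤++ {k} {m} {n} H D (suc j) C ∣C∣≡1+j = begin
  sumᶠ g
    ≡⟨ sum-↑ k g ⟩
  ∑[ i < k ] g (i ↑ˡ n) + ∑[ i < n ] g (k ↑ʳ i)
    ≡⟨ cong₂ _+_ (sum-cong-≗ left)
         (sum-0 λ i → cong (λ z → z * χ (C ++ D) (k ↑ʳ i) * permanent B ((C ++ D) ∖ (k ↑ʳ i)))
                           (trans (χ-++ʳ (⊤ {k}) (⊥ {n}) i) (χ-⊥ i))) ⟩
  ∑[ i < k ] (χ ⊤ i * χ C i * Q) + 0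
    ≡⟨ +-identityʳ _ ⟩
  ∑[ i < k ] (χ ⊤ i * χ C i * Q)
    ≡⟨ *-distribʳ-sum Q (λ i → χ ⊤ i * χ C i) ⟨
  deg ⊤ C * Q
    ≡⟨ cong (_* Q) ∣C∣≡1+j ⟩
  suc j * Q
    ≡⟨ *-assoc (suc j) (j !) _ ⟨
  suc j * j ! * permanent (lookup H) D ∎
  where
  open ≡-Reasoning
  B = lookup (replicate j (⊤ {k} ++ ⊥ {n}) ++ Vec.map (⊥ {k} ++_) H)
  g = λ l → χ (⊤ {k} ++ ⊥ {n}) l * χ (C ++ D) l * permanent B ((C ++ D) ∖ l)
  Q = j ! * permanent (lookup H) D
  left : ∀ i → g (i ↑ˡ n) ≡ χ ⊤ i * χ C i * Q
  left i rewrite χ-++ˡ (⊤ {k}) (⊥ {n}) i | χ-++ˡ C D i | []≔-++-↑ˡ {x = outside} C D i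
    with lookup C i | deg-∖ ⊤ C i
  ... | false | _  rewrite *-zeroʳ (χ (⊤ {k}) i) = refl
  ... | true  | eq rewrite χ-⊤ i = cong (_+ 0)
    (permanent-⊤++ H D j (C ∖ i) (suc-injective (trans (sym eq) ∣C∣≡1+j)))

⊤++⊤ : ∀ m {n} → ⊤ {m + n} ≡ ⊤ {m} ++ ⊤ {n}
⊤++⊤ zero    = refl
⊤++⊤ (suc m) = cong (inside ∷_) (⊤++⊤ m)

permanent-⨄K : ∀ k ks → permanent (lookup (⨄K (k ∷ ks))) ⊤ ≡ k ! * permanent (lookup (⨄K ks)) ⊤
permanent-⨄K k ks = trans
  (cong₂ (λ V C → permanent (lookup (V ++ Vec.map (⊥ ++_) (⨄K ks))) C)
    (map-replicate (_++ ⊥) (⊤ {k}) k) (⊤++⊤ k))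
  (permanent-⊤++ (⨄K ks) ⊤ k ⊤ (deg-⊤-⊤ k))

∣++∣ : ∀ {m n} (p : Subset m) (q : Subset n) → ∣ p ++ q ∣ ≡ ∣ p ∣ + ∣ q ∣
∣++∣ []          q = refl
∣++∣ (true ∷ p)  q = cong suc (∣++∣ p q)
∣++∣ (false ∷ p) q = ∣++∣ p q

leftDegree-↑ˡ : ∀ k ks x → leftDegree (⨄K (k ∷ ks)) (x ↑ˡ sum ks) ≡ k
leftDegree-↑ˡ k ks x = begin
  ∣ lookup (⨄K (k ∷ ks)) (x ↑ˡ sum ks) ∣  ≡⟨ cong ∣_∣ (lookup-++ˡ (Vec.map (_++ ⊥) (K k k)) _ x) ⟩
  ∣ lookup (Vec.map (_++ ⊥) (K k k)) x ∣   ≡⟨ cong ∣_∣ (lookup-map x (_++ ⊥) (K k k)) ⟩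
  ∣ lookup (K k k) x ++ ⊥ ∣                ≡⟨ cong (λ p → ∣ p ++ ⊥ ∣) (lookup-replicate x (⊤ {k})) ⟩
  ∣ ⊤ {k} ++ ⊥ {sum ks} ∣                 ≡⟨ ∣++∣ (⊤ {k}) ⊥ ⟩
  ∣ ⊤ {k} ∣ + ∣ ⊥ {sum ks} ∣              ≡⟨ cong₂ _+_ (∣⊤∣≡n k) (∣⊥∣≡0 (sum ks)) ⟩
  k + 0                                    ≡⟨ +-identityʳ k ⟩
  k                                        ∎
  where open ≡-Reasoning

leftDegree-↑ʳ : ∀ k ks x → leftDegree (⨄K (k ∷ ks)) (k ↑ʳ x) ≡ leftDegree (⨄K ks) x
leftDegree-↑ʳ k ks x = begin
  ∣ lookup (⨄K (k ∷ ks)) (k ↑ʳ x) ∣            ≡⟨ cong ∣_∣ (lookup-++ʳ (Vec.map (_++ ⊥) (K k k)) _ x) ⟩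
  ∣ lookup (Vec.map (⊥ {k} ++_) (⨄K ks)) x ∣   ≡⟨ cong ∣_∣ (lookup-map x (⊥ {k} ++_) (⨄K ks)) ⟩
  ∣ ⊥ {k} ++ lookup (⨄K ks) x ∣                ≡⟨ ∣++∣ (⊥ {k}) (lookup (⨄K ks) x) ⟩
  ∣ ⊥ {k} ∣ + leftDegree (⨄K ks) x             ≡⟨ cong (_+ leftDegree (⨄K ks) x) (∣⊥∣≡0 k) ⟩
  leftDegree (⨄K ks) x                         ∎
  where open ≡-Reasoning

-- Equality in Brègman's bound and the comparison

product-map-tabulate : ∀ {n} (f : ℕ → ℕ) (d : Fin n → ℕ) →
                       product (List.map f (List.tabulate d)) ≡ ∏[ i < n ] f (d i)
product-map-tabulate {zero}  f d = refl
product-map-tabulate {suc n} f d = cong (f (d zero) *_) (product-map-tabulate f (d ∘ suc))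

module _ {N L} .{{_ : NonZero L}} (g : ℕ → ℕ)
         (g*r≡L : ∀ r → .{{NonZero r}} → r ≤ N → g r * r ≡ L) where
  open Bregman g g*r≡L

  -- The `k` rows of a block contribute `f k ^ k`, which is `(k !) ^ L`, matching its factor `k !`
  -- in the permanent. `N` stays fixed while the list shrinks, hence an inequality as hypothesis.
  bregman-⨄K : ∀ ks → sum ks ≤ N →
               ∏[ x < sum ks ] f (leftDegree (⨄K ks) x) ≡ permanent (lookup (⨄K ks)) ⊤ ^ L
  bregman-⨄K []       _  = sym (^-zeroˡ L)
  bregman-⨄K (k ∷ ks) Σ≤N = begin
    ∏[ x < k + sum ks ] f (leftDegree (⨄K (k ∷ ks)) x)
      ≡⟨ prod-↑ k (λ x → f (leftDegree (⨄K (k ∷ ks)) x)) ⟩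
    ∏[ x < k ] f (leftDegree (⨄K (k ∷ ks)) (x ↑ˡ sum ks)) *
      ∏[ x < sum ks ] f (leftDegree (⨄K (k ∷ ks)) (k ↑ʳ x))
      ≡⟨ cong₂ _*_ (trans (prod-cong-≗ λ x → cong f (leftDegree-↑ˡ k ks x)) (f^k k (m+n≤o⇒m≤o k Σ≤N)))
           (trans (prod-cong-≗ λ x → cong f (leftDegree-↑ʳ k ks x)) (bregman-⨄K ks (m+n≤o⇒n≤o k Σ≤N))) ⟩
    (k !) ^ L * permanent (lookup (⨄K ks)) ⊤ ^ L
      ≡⟨ *-^-distribʳ (k !) _ L ⟨
    (k ! * permanent (lookup (⨄K ks)) ⊤) ^ L
      ≡⟨ cong (_^ L) (permanent-⨄K k ks) ⟨
    permanent (lookup (⨄K (k ∷ ks))) ⊤ ^ L ∎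
    where
    open ≡-Reasoning
    f^k : ∀ k → k ≤ N → ∏[ x < k ] f k ≡ (k !) ^ L
    f^k zero      _   = sym (^-zeroˡ L)
    f^k k@(suc _) k≤N = trans (prod-const k (f k)) (f^r k k≤N)

lemma2 : (ks : List ℕ) → All (λ k → 1 ≤ k) ks →
    (G : BipartiteGraph (sum ks) (sum ks)) →
    leftDegrees G ↭ leftDegrees (⨄K ks) →
    #perfectMatchings G ≤ #perfectMatchings (⨄K ks)
lemma2 ks _ G degrees =
  subst₂ _≤_ (sym (#perfectMatchings≡permanent G)) (sym (#perfectMatchings≡permanent (⨄K ks)))
    (^-cancelʳ-≤ L (begin
      permanent (lookup G) ⊤ ^ L
        ≤⟨ bregman (lookup G) ⊤ ⟩
      ∏[ x < N ] f (deg (lookup G x) ⊤)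
        ≡⟨ prod-cong-≗ (λ x → cong f (deg-⊤ (lookup G x))) ⟩
      ∏[ x < N ] f (leftDegree G x)
        ≡⟨ product-map-tabulate f (leftDegree G) ⟨
      product (List.map f (leftDegrees G))
        -- Brègman's bound depends only on the multiset of left degrees.
        ≡⟨ product-↭ (map⁺ f degrees) ⟩
      product (List.map f (leftDegrees (⨄K ks)))
        ≡⟨ product-map-tabulate f (leftDegree (⨄K ks)) ⟩
      ∏[ x < N ] f (leftDegree (⨄K ks) x)
        ≡⟨ bregman-⨄K g g*r≡L ks ≤-refl ⟩
      permanent (lookup (⨄K ks)) ⊤ ^ L ∎))
  where
  open ≤-Reasoning
  N = sum ks
  L = N !
  g : ℕ → ℕ
  g zero      = 0
  g r@(suc _) = L / r
  g*r≡L : ∀ r → .{{NonZero r}} → r ≤ N → g r * r ≡ L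
  -- `r` divides `r !`, which divides `N !`.
  g*r≡L r@(suc s) r≤N = m/n*n≡m (∣-trans (m∣m*n (s !)) (m≤n⇒m!∣n! r≤N))
  instance
    L≢0 : NonZero L
    L≢0 = N !≢0
  open Bregman g g*r≡L
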